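{- Each of VCPNEW, VCOP and VCUP is equivalent to the minimum weight vertex cover problem (MWVCP): every instance of one can be formulated as an instance of the other on the same graph so that an optimal solution of the new instance is an optimal solution of the original instance.
   Context: Let $G=(V,E)$ be a graph, with vertex weights $c_i\in\mathbb{R}$ and edge weights $q^1_{ij},q^2_{ij}\in\mathbb{R}$. A vertex cover is a set $P\subseteq V$ containing at least one endpoint of every edge. For $P\subseteq V$ let $E_1(P)$ be the edges with exactly one endpoint in $P$ and $E_2(P)$ the edges with both endpoints in $P$. VCPNEW is to find a vertex cover $P$ minimizing $\sum_{i\in P}c_i+\sum_{(i,j)\in E_1(P)}q^1_{ij}+\sum_{(i,j)\in E_2(P)}q^2_{ij}$; VCOP is the special case $q^1\equiv0$; VCUP is the special case $q^2\equiv0$. MWVCP: given real vertex weights $w_i$, find a vertex cover $P$ minimizing $\sum_{i\in P}w_i$. -}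

module Defs where

open import Algebra.Bundles.Raw using (RawMonoid)
import Algebra.Definitions.RawMonoid as RawMonoidDefinitions
open import Data.Bool.Base using (if_then_else_; _∧_; _xor_)
open import Data.Fin.Base as Fin using (Fin)
open import Data.Fin.Subset using (Subset; _∈_)
open import Data.Nat.Base as ℕ using (ℕ)
import Data.Nat.Properties as ℕ
open import Data.Product.Base using (Σ-syntax; ∃-syntax; _×_; _,_; proj₁; proj₂)
open import Data.Rational.Base as ℚ using (ℚ; 0ℚ; ½)
import Data.Rational.Properties as ℚ
open import Data.Rational.Solver using (module +-*-Solver)
open import Data.Sum.Base using (_⊎_)
open import Data.Vec.Base using (lookup; tabulate)
open import Function.Definitions using (Injective)
open import Level using (0ℓ)
open import Relation.Binary.PropositionalEquality using (_≡_; refl; subst; cong)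

-- The real numbers, as Cauchy sequences of rationals; equality of reals is _≈_.

IsCauchy : (ℕ → ℚ) → Set
IsCauchy x = ∀ ε → 0ℚ ℚ.< ε →
  ∃[ N ] (∀ m n → N ℕ.≤ m → N ℕ.≤ n → ℚ.∣ x m ℚ.- x n ∣ ℚ.≤ ε)

record ℝ : Set where
  constructor mkℝ
  field
    seq    : ℕ → ℚ
    cauchy : IsCauchy seq

open ℝ public

infix 4 _≈_ _≤_
infixl 6 _+_

_≈_ : ℝ → ℝ → Set
x ≈ y = ∀ ε → 0ℚ ℚ.< ε →
  ∃[ N ] (∀ n → N ℕ.≤ n → ℚ.∣ seq x n ℚ.- seq y n ∣ ℚ.≤ ε)

_≤_ : ℝ → ℝ → Set
x ≤ y = ∀ ε → 0ℚ ℚ.< ε →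
  ∃[ N ] (∀ n → N ℕ.≤ n → seq x n ℚ.≤ seq y n ℚ.+ ε)

0ℝ : ℝ
0ℝ = mkℝ (λ _ → 0ℚ) (λ ε 0<ε → 0 , λ _ _ _ _ → ℚ.<⇒≤ 0<ε)

half-pos : ∀ ε → 0ℚ ℚ.< ε → 0ℚ ℚ.< ½ ℚ.* ε
half-pos ε 0<ε = subst (ℚ._< ½ ℚ.* ε) (ℚ.*-zeroʳ ½) (ℚ.*-monoʳ-<-pos ½ 0<ε)

half+half : ∀ ε → ½ ℚ.* ε ℚ.+ ½ ℚ.* ε ≡ ε
half+half = solve 1 (λ ε → con ½ :* ε :+ con ½ :* ε := ε) refl
  where open +-*-Solver

+-cauchy : ∀ x y → IsCauchy x → IsCauchy y → IsCauchy (λ n → x n ℚ.+ y n)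
+-cauchy x y cx cy ε 0<ε
  with N₁ , h₁ ← cx (½ ℚ.* ε) (half-pos ε 0<ε)
     | N₂ , h₂ ← cy (½ ℚ.* ε) (half-pos ε 0<ε)
  = N₁ ℕ.⊔ N₂ , λ m n N≤m N≤n → begin
    ℚ.∣ (x m ℚ.+ y m) ℚ.- (x n ℚ.+ y n) ∣
      ≡⟨ cong ℚ.∣_∣ (regroup (x m) (y m) (x n) (y n)) ⟩
    ℚ.∣ (x m ℚ.- x n) ℚ.+ (y m ℚ.- y n) ∣
      ≤⟨ ℚ.∣p+q∣≤∣p∣+∣q∣ (x m ℚ.- x n) (y m ℚ.- y n) ⟩
    ℚ.∣ x m ℚ.- x n ∣ ℚ.+ ℚ.∣ y m ℚ.- y n ∣
      ≤⟨ ℚ.+-mono-≤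
           (h₁ m n (ℕ.m⊔n≤o⇒m≤o N₁ N₂ N≤m) (ℕ.m⊔n≤o⇒m≤o N₁ N₂ N≤n))
           (h₂ m n (ℕ.m⊔n≤o⇒n≤o N₁ N₂ N≤m) (ℕ.m⊔n≤o⇒n≤o N₁ N₂ N≤n)) ⟩
    ½ ℚ.* ε ℚ.+ ½ ℚ.* ε
      ≡⟨ half+half ε ⟩
    ε ∎
  where
  open ℚ.≤-Reasoning
  open +-*-Solver
  regroup : ∀ a b c d → (a ℚ.+ b) ℚ.- (c ℚ.+ d) ≡ (a ℚ.- c) ℚ.+ (b ℚ.- d)
  regroup = solve 4
    (λ a b c d → (a :+ b) :- (c :+ d) := (a :- c) :+ (b :- d)) refl

_+_ : ℝ → ℝ → ℝ
x + y = mkℝ (λ n → seq x n ℚ.+ seq y n) (+-cauchy (seq x) (seq y) (cauchy x) (cauchy y))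

+-0-rawMonoid : RawMonoid 0ℓ 0ℓ
+-0-rawMonoid = record { Carrier = ℝ ; _≈_ = _≈_ ; _∙_ = _+_ ; ε = 0ℝ }

open RawMonoidDefinitions +-0-rawMonoid using (sum)

sumOver : ∀ {n} → Subset n → (Fin n → ℝ) → ℝ
sumOver S f = sum (λ i → if lookup S i then f i else 0ℝ)

-- Finite simple graphs on the vertex set Fin order.  The edges are enumerated
-- by Fin size; the unordered pair {i , j} with i < j is stored as (i , j), so
-- there are no loops, and injectivity rules out parallel edges.

record Graph : Set where
  field
    order     : ℕ
    size      : ℕ
    ends      : Fin size → Fin order × Fin order
    ordered   : ∀ e → proj₁ (ends e) Fin.< proj₂ (ends e)
    injective : Injective _≡_ _≡_ ends

  Vertex Edge : Set
  Vertex = Fin order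
  Edge   = Fin size

  src tgt : Edge → Vertex
  src e = proj₁ (ends e)
  tgt e = proj₂ (ends e)

  IsVertexCover : Subset order → Set
  IsVertexCover P = ∀ e → src e ∈ P ⊎ tgt e ∈ P

  E₁ E₂ : Subset order → Subset size
  E₁ P = tabulate (λ e → lookup P (src e) xor lookup P (tgt e))
  E₂ P = tabulate (λ e → lookup P (src e) ∧ lookup P (tgt e))

open Graph

-- A minimisation problem over the vertex covers of a graph: on each graph, a
-- collection of instances, each with its objective function.

record CoverProblem : Set₁ where
  field
    Instance : Graph → Set
    cost     : ∀ G → Instance G → Subset (order G) → ℝ

  IsOptimal : ∀ G → Instance G → Subset (order G) → Set
  IsOptimal G I P =
    IsVertexCover G P × (∀ Q → IsVertexCover G Q → cost G I P ≤ cost G I Q)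

open CoverProblem

record PairWeights (G : Graph) : Set where
  field
    c     : Vertex G → ℝ
    q¹ q² : Edge G → ℝ

open PairWeights

pairCost : ∀ G → PairWeights G → Subset (order G) → ℝ
pairCost G I P = sumOver P (c I) + sumOver (E₁ G P) (q¹ I) + sumOver (E₂ G P) (q² I)

VCPNEW : CoverProblem
VCPNEW = record { Instance = PairWeights ; cost = pairCost }

VCOP : CoverProblem
VCOP = record
  { Instance = λ G → Σ[ I ∈ PairWeights G ] (∀ e → q¹ I e ≈ 0ℝ)
  ; cost     = λ G (I , _) → pairCost G I
  }

VCUP : CoverProblem
VCUP = record
  { Instance = λ G → Σ[ I ∈ PairWeights G ] (∀ e → q² I e ≈ 0ℝ)
  ; cost     = λ G (I , _) → pairCost G I
  }

MWVCP : CoverProblem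
MWVCP = record
  { Instance = λ G → Vertex G → ℝ
  ; cost     = λ G w P → sumOver P w
  }

FormulableAs : CoverProblem → CoverProblem → Set
FormulableAs A B = ∀ G (I : Instance A G) →
  Σ[ J ∈ Instance B G ] (∀ P → IsOptimal B G J P → IsOptimal A G I P)

Equivalent : CoverProblem → CoverProblem → Set
Equivalent A B = FormulableAs A B × FormulableAs B A

{-# OPTIONS --safe #-}
-- On a vertex cover every edge e has one or two endpoints in P, so the cost of e is
-- affine in their number: with d = q² - q¹ it equals (number of endpoints) · d - (d - q¹).
-- Distributing d to both endpoints of each edge therefore turns the objective into a
-- vertex weight, up to a constant independent of P.  All identities between
-- objectives hold exactly at each index of the representing Cauchy sequences.
module Submission where

open import Defs
open import Algebra.Definitions.RawMonoid +-0-rawMonoid using () renaming (sum to sumℝ)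
import Algebra.Properties.CommutativeMonoid.Sum as CommutativeMonoidSum
open import Data.Bool.Base using (Bool; true; false; if_then_else_; _∧_; _∨_; _xor_)
open import Data.Bool.Properties using (if-eta; if-float; ∨-zeroʳ)
open import Data.Fin.Base using (Fin; zero; suc)
open import Data.Fin.Properties using (_≟_)
open import Data.Fin.Subset using (Subset)
open import Data.Nat.Base using (ℕ)
open import Data.Product.Base using (Σ-syntax; _×_; _,_; map₂)
open import Data.Rational.Base as ℚ using (ℚ; 0ℚ)
import Data.Rational.Properties as ℚ
open import Data.Rational.Solver using (module +-*-Solver)
open import Data.Sum.Base using (inj₁; inj₂)
open import Data.Vec.Base using (lookup; tabulate)
open import Data.Vec.Properties using (lookup∘tabulate; []=⇒lookup)
open import Relation.Binary.PropositionalEquality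
  using (_≡_; refl; sym; trans; cong; cong₂; subst₂; module ≡-Reasoning)
open import Relation.Nullary.Decidable using (does)

open CommutativeMonoidSum ℚ.+-0-commutativeMonoid
open Graph
open CoverProblem
open PairWeights

-- Finite rational sums with indicator coefficients

infixl 7 _⊙_

_⊙_ : Bool → ℚ → ℚ
b ⊙ x = if b then x else 0ℚ

⊙-distribˡ-+ : ∀ b x y → b ⊙ (x ℚ.+ y) ≡ b ⊙ x ℚ.+ b ⊙ y
⊙-distribˡ-+ false x y = refl
⊙-distribˡ-+ true  x y = refl

⊙-distribˡ-∑ : ∀ {n} b (f : Fin n → ℚ) → b ⊙ (∑[ i < n ] f i) ≡ ∑[ i < n ] (b ⊙ f i)
⊙-distribˡ-∑ {n} false f = sym (sum-replicate-zero n)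
⊙-distribˡ-∑     true  f = refl

∑-⊙-zero : ∀ {n} (b : Fin n → Bool) → ∑[ i < n ] (b i ⊙ 0ℚ) ≡ 0ℚ
∑-⊙-zero {n} b = trans (sum-cong-≗ (λ i → if-eta (b i))) (sum-replicate-zero n)

-- `does (j ≟ i)` is a Kronecker delta, so every term away from `j` is some `b i ⊙ 0ℚ` and vanishes.
∑-⊙-≟ : ∀ {n} (b : Fin n → Bool) j x →
        ∑[ i < n ] (b i ⊙ (does (j ≟ i) ⊙ x)) ≡ b j ⊙ x
∑-⊙-≟ b zero    x = trans (cong (b zero ⊙ x ℚ.+_) (∑-⊙-zero (λ i → b (suc i)))) (ℚ.+-identityʳ _)
∑-⊙-≟ b (suc j) x = trans (cong₂ ℚ._+_ (if-eta (b zero)) (∑-⊙-≟ (λ i → b (suc i)) j x))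
                          (ℚ.+-identityˡ _)

-- Double counting: each `e` lies in exactly one fibre of `f`, so after interchanging the sums only
-- `i = f e` survives. With `f` an endpoint map, this turns a sum over vertices into a sum over
-- edges.
∑-fibres : ∀ {m n} (b : Fin n → Bool) (f : Fin m → Fin n) (x : Fin m → ℚ) →
           ∑[ i < n ] (b i ⊙ (∑[ e < m ] (does (f e ≟ i) ⊙ x e))) ≡ ∑[ e < m ] (b (f e) ⊙ x e)
∑-fibres {m} {n} b f x = begin
  ∑[ i < n ] (b i ⊙ (∑[ e < m ] (does (f e ≟ i) ⊙ x e)))
    ≡⟨ sum-cong-≗ (λ i → ⊙-distribˡ-∑ (b i) (λ e → does (f e ≟ i) ⊙ x e)) ⟩
  ∑[ i < n ] ∑[ e < m ] (b i ⊙ (does (f e ≟ i) ⊙ x e))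
    ≡⟨ ∑-comm (λ i e → b i ⊙ (does (f e ≟ i) ⊙ x e)) ⟩
  ∑[ e < m ] ∑[ i < n ] (b i ⊙ (does (f e ≟ i) ⊙ x e))
    ≡⟨ sum-cong-≗ (λ e → ∑-⊙-≟ b (f e) (x e)) ⟩
  ∑[ e < m ] (b (f e) ⊙ x e) ∎
  where open ≡-Reasoning

-- Real sums evaluated at one index of their sequences

seq-sum : ∀ {n} (f : Fin n → ℝ) k → seq (sumℝ f) k ≡ ∑[ i < n ] seq (f i) k
seq-sum {ℕ.zero}  f k = refl
seq-sum {ℕ.suc n} f k = cong (seq (f zero) k ℚ.+_) (seq-sum (λ i → f (suc i)) k)

seq-sumOver : ∀ {n} (S : Subset n) (f : Fin n → ℝ) k →
              seq (sumOver S f) k ≡ ∑[ i < n ] (lookup S i ⊙ seq (f i) k)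
seq-sumOver S f k = trans
  (seq-sum (λ i → if lookup S i then f i else 0ℝ) k)
  (sum-cong-≗ (λ i → if-float (λ x → seq x k) (lookup S i)))

seq-sumOver-tabulate : ∀ {n} (b : Fin n → Bool) (f : Fin n → ℝ) k →
                       seq (sumOver (tabulate b) f) k ≡ ∑[ i < n ] (b i ⊙ seq (f i) k)
seq-sumOver-tabulate b f k = trans
  (seq-sumOver (tabulate b) f k)
  (sum-cong-≗ (λ i → cong (_⊙ seq (f i) k) (lookup∘tabulate b i)))

-- Real subtraction, and comparison of shifted objectives

infixl 6 _-_

-_ : ℝ → ℝ
- x = mkℝ (λ n → ℚ.- seq x n) λ ε 0<ε → map₂ (λ h m n N≤m N≤n →
  ℚ.≤-trans (ℚ.≤-reflexive (∣-∣-neg (seq x m) (seq x n))) (h m n N≤m N≤n)) (cauchy x ε 0<ε)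
  where
  open +-*-Solver
  ∣-∣-neg : ∀ p q → ℚ.∣ ℚ.- p ℚ.- (ℚ.- q) ∣ ≡ ℚ.∣ p ℚ.- q ∣
  ∣-∣-neg p q = trans
    (cong ℚ.∣_∣ (solve 2 (λ a b → (:- a) :- (:- b) := :- (a :- b)) refl p q))
    (ℚ.∣-p∣≡∣p∣ (p ℚ.- q))

_-_ : ℝ → ℝ → ℝ
x - y = x + (- y)

-- At each index both sides are moved by the same rational `s k`, so subtracting it from the bound
-- for `y` and `y′` gives the bound for `x` and `x′`, with the same `ε` and `N`.
≤-cancel-shift : ∀ {x x′ y y′} (s : ℕ → ℚ) →
                 (∀ k → seq x k ℚ.+ s k ≡ seq y k) → (∀ k → seq x′ k ℚ.+ s k ≡ seq y′ k) →
                 y ≤ y′ → x ≤ x′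
≤-cancel-shift {x} {x′} s x+s≡y x′+s≡y′ y≤y′ ε 0<ε with y≤y′ ε 0<ε
... | N , h = N , λ k N≤k → subst₂ ℚ._≤_
  (trans (cong (ℚ._- s k) (sym (x+s≡y k))) (cancel (seq x k) (s k)))
  (trans (cong (λ z → z ℚ.+ ε ℚ.- s k) (sym (x′+s≡y′ k))) (cancel′ (seq x′ k) (s k) ε))
  (ℚ.+-monoˡ-≤ (ℚ.- s k) (h k N≤k))
  where
  open +-*-Solver
  cancel : ∀ p q → p ℚ.+ q ℚ.- q ≡ p
  cancel = solve 2 (λ p q → p :+ q :- q := p) refl
  cancel′ : ∀ p q r → p ℚ.+ q ℚ.+ r ℚ.- q ≡ p ℚ.+ r
  cancel′ = solve 3 (λ p q r → p :+ q :+ r :- q := p :+ r) refl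

-- The shift may depend on the instance but not on `P`, so it cancels whenever two covers are
-- compared. Optimality compares covers only, hence the identity is asked for on covers.
shift⇒formulable : ∀ A B →
  (∀ G (I : Instance A G) → Σ[ J ∈ Instance B G ] Σ[ s ∈ (ℕ → ℚ) ]
    (∀ P → IsVertexCover G P → ∀ k → seq (cost A G I P) k ℚ.+ s k ≡ seq (cost B G J P) k)) →
  FormulableAs A B
shift⇒formulable A B reduce G I with reduce G I
... | J , s , shift = J , λ P (cover , opt) → cover , λ Q coverQ → ≤-cancel-shift
  {cost A G I P} {cost A G I Q} {cost B G J P} {cost B G J Q}
  s (shift P cover) (shift Q coverQ) (opt Q coverQ)

-- From edge weights to vertex weights

edgeExcess : ∀ {G} → PairWeights G → Edge G → ℝ
edgeExcess I e = q² I e - q¹ I e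

-- The two shares together add up the excess of all edges at `i`. Splitting them by `src` and `tgt`
-- makes each one a sum over a fibre, the form treated by `∑-fibres`.
vertexWeights : ∀ G → PairWeights G → Vertex G → ℝ
vertexWeights G I i = c I i + (shareOf (src G) + shareOf (tgt G))
  where
  shareOf : (Edge G → Vertex G) → ℝ
  shareOf end = sumOver (tabulate (λ e → does (end e ≟ i))) (edgeExcess I)

offset : ∀ G → PairWeights G → ℕ → ℚ
offset G I k = ∑[ e < size G ] seq (edgeExcess I e - q¹ I e) k

-- Regrouping the shares by edge instead of by vertex, each edge pays `d e` once per endpoint in
-- `P`.
seq-weightedCover : ∀ G (I : PairWeights G) P k →
  let d = λ e → seq (edgeExcess I e) k in
  seq (sumOver P (vertexWeights G I)) k ≡
  ∑[ i < order G ] (lookup P i ⊙ seq (c I i) k) ℚ.+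
  ∑[ e < size G ] (lookup P (src G e) ⊙ d e ℚ.+ lookup P (tgt G e) ⊙ d e)
seq-weightedCover G I P k = begin
  seq (sumOver P (vertexWeights G I)) k
    ≡⟨ seq-sumOver P (vertexWeights G I) k ⟩
  ∑[ i < order G ] (b i ⊙ seq (vertexWeights G I i) k)
    ≡⟨ sum-cong-≗ split ⟩
  ∑[ i < order G ] (b i ⊙ seq (c I i) k ℚ.+ (b i ⊙ share (src G) i ℚ.+ b i ⊙ share (tgt G) i))
    ≡⟨ ∑-distrib-+ (λ i → b i ⊙ seq (c I i) k) _ ⟩
  C ℚ.+ ∑[ i < order G ] (b i ⊙ share (src G) i ℚ.+ b i ⊙ share (tgt G) i)
    ≡⟨ cong (C ℚ.+_) (∑-distrib-+ (λ i → b i ⊙ share (src G) i) _) ⟩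
  C ℚ.+ (∑[ i < order G ] (b i ⊙ share (src G) i) ℚ.+ ∑[ i < order G ] (b i ⊙ share (tgt G) i))
    ≡⟨ cong (C ℚ.+_) (cong₂ ℚ._+_ (∑-fibres b (src G) d) (∑-fibres b (tgt G) d)) ⟩
  C ℚ.+ (∑[ e < size G ] (b (src G e) ⊙ d e) ℚ.+ ∑[ e < size G ] (b (tgt G e) ⊙ d e))
    ≡⟨ cong (C ℚ.+_) (∑-distrib-+ (λ e → b (src G e) ⊙ d e) _) ⟨
  C ℚ.+ ∑[ e < size G ] (b (src G e) ⊙ d e ℚ.+ b (tgt G e) ⊙ d e) ∎
  where
  open ≡-Reasoning
  b : Vertex G → Bool
  b = lookup P
  d : Edge G → ℚ
  d e = seq (edgeExcess I e) k
  C : ℚ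
  C = ∑[ i < order G ] (b i ⊙ seq (c I i) k)
  share : (Edge G → Vertex G) → Vertex G → ℚ
  share end i = ∑[ e < size G ] (does (end e ≟ i) ⊙ d e)
  split : ∀ i → b i ⊙ seq (vertexWeights G I i) k ≡
                b i ⊙ seq (c I i) k ℚ.+ (b i ⊙ share (src G) i ℚ.+ b i ⊙ share (tgt G) i)
  split i = begin
    b i ⊙ seq (vertexWeights G I i) k
      ≡⟨ cong (λ z → b i ⊙ (seq (c I i) k ℚ.+ z)) (cong₂ ℚ._+_
           (seq-sumOver-tabulate (λ e → does (src G e ≟ i)) (edgeExcess I) k)
           (seq-sumOver-tabulate (λ e → does (tgt G e ≟ i)) (edgeExcess I) k)) ⟩
    b i ⊙ (seq (c I i) k ℚ.+ (share (src G) i ℚ.+ share (tgt G) i))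
      ≡⟨ ⊙-distribˡ-+ (b i) _ _ ⟩
    b i ⊙ seq (c I i) k ℚ.+ b i ⊙ (share (src G) i ℚ.+ share (tgt G) i)
      ≡⟨ cong (b i ⊙ seq (c I i) k ℚ.+_) (⊙-distribˡ-+ (b i) _ _) ⟩
    b i ⊙ seq (c I i) k ℚ.+ (b i ⊙ share (src G) i ℚ.+ b i ⊙ share (tgt G) i) ∎

seq-pairCost : ∀ G (I : PairWeights G) P k →
  seq (pairCost G I P) k ≡
  ∑[ i < order G ] (lookup P i ⊙ seq (c I i) k) ℚ.+
  ∑[ e < size G ] ((lookup P (src G e) xor lookup P (tgt G e)) ⊙ seq (q¹ I e) k) ℚ.+
  ∑[ e < size G ] ((lookup P (src G e) ∧ lookup P (tgt G e)) ⊙ seq (q² I e) k)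
seq-pairCost G I P k = cong₂ ℚ._+_
  (cong₂ ℚ._+_ (seq-sumOver P (c I) k) (seq-sumOver-tabulate _ (q¹ I) k))
  (seq-sumOver-tabulate _ (q² I) k)

-- A price `δ` per endpoint and a constant `κ` must satisfy `p + κ = δ` and `q + κ = 2δ`, which
-- forces `δ = q - p` and `κ = q - 2p`. An uncovered edge would demand `κ = 0`; the hypothesis
-- excludes that case.
covered-edge : ∀ s t p q → s ∨ t ≡ true →
  (s xor t) ⊙ p ℚ.+ (s ∧ t) ⊙ q ℚ.+ (q ℚ.- p ℚ.- p) ≡ s ⊙ (q ℚ.- p) ℚ.+ t ⊙ (q ℚ.- p)
covered-edge true  true  p q _ = solve 2
  (λ p q → con 0ℚ :+ q :+ (q :- p :- p) := (q :- p) :+ (q :- p)) refl p q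
  where open +-*-Solver
covered-edge true  false p q _ = solve 2
  (λ p q → p :+ con 0ℚ :+ (q :- p :- p) := (q :- p) :+ con 0ℚ) refl p q
  where open +-*-Solver
covered-edge false true  p q _ = solve 2
  (λ p q → p :+ con 0ℚ :+ (q :- p :- p) := con 0ℚ :+ (q :- p)) refl p q
  where open +-*-Solver

cover⇒∨ : ∀ G P → IsVertexCover G P → ∀ e → lookup P (src G e) ∨ lookup P (tgt G e) ≡ true
cover⇒∨ G P cover e with cover e
... | inj₁ s∈P = cong (_∨ lookup P (tgt G e)) ([]=⇒lookup s∈P)
... | inj₂ t∈P = trans (cong (lookup P (src G e) ∨_) ([]=⇒lookup t∈P)) (∨-zeroʳ _)

pairCost-shift : ∀ G (I : PairWeights G) P → IsVertexCover G P → ∀ k →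
  seq (pairCost G I P) k ℚ.+ offset G I k ≡ seq (sumOver P (vertexWeights G I)) k
pairCost-shift G I P cover k = begin
  seq (pairCost G I P) k ℚ.+ offset G I k
    ≡⟨ cong (ℚ._+ offset G I k) (seq-pairCost G I P k) ⟩
  C ℚ.+ sum X ℚ.+ sum Y ℚ.+ sum K
    ≡⟨ solve 4 (λ a b c d → a :+ b :+ c :+ d := a :+ (b :+ c :+ d)) refl C (sum X) (sum Y) (sum K) ⟩
  C ℚ.+ (sum X ℚ.+ sum Y ℚ.+ sum K)
    ≡⟨ cong (λ z → C ℚ.+ (z ℚ.+ sum K)) (∑-distrib-+ X Y) ⟨
  C ℚ.+ (∑[ e < size G ] (X e ℚ.+ Y e) ℚ.+ sum K)
    ≡⟨ cong (C ℚ.+_) (∑-distrib-+ (λ e → X e ℚ.+ Y e) K) ⟨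
  C ℚ.+ ∑[ e < size G ] (X e ℚ.+ Y e ℚ.+ K e)
    -- With all edge terms in one sum, the identity can be applied edge by edge; this is where `P`
    -- being a cover enters.
    ≡⟨ cong (C ℚ.+_) (sum-cong-≗ (λ e →
         covered-edge (s e) (t e) (seq (q¹ I e) k) (seq (q² I e) k) (cover⇒∨ G P cover e))) ⟩
  C ℚ.+ ∑[ e < size G ] (s e ⊙ seq (edgeExcess I e) k ℚ.+ t e ⊙ seq (edgeExcess I e) k)
    ≡⟨ seq-weightedCover G I P k ⟨
  seq (sumOver P (vertexWeights G I)) k ∎
  where
  open ≡-Reasoning
  open +-*-Solver using (solve; _:+_; _:=_)
  s t : Edge G → Bool
  s e = lookup P (src G e)
  t e = lookup P (tgt G e)
  C : ℚ
  C = ∑[ i < order G ] (lookup P i ⊙ seq (c I i) k)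
  X Y K : Edge G → ℚ
  X e = (s e xor t e) ⊙ seq (q¹ I e) k
  Y e = (s e ∧ t e) ⊙ seq (q² I e) k
  K e = seq (edgeExcess I e - q¹ I e) k

-- From vertex weights to pair weights

withoutEdgeWeights : ∀ G → (Vertex G → ℝ) → PairWeights G
withoutEdgeWeights G w = record { c = w ; q¹ = λ _ → 0ℝ ; q² = λ _ → 0ℝ }

pairCost-withoutEdgeWeights : ∀ G (w : Vertex G → ℝ) P k →
  seq (sumOver P w) k ℚ.+ 0ℚ ≡ seq (pairCost G (withoutEdgeWeights G w) P) k
pairCost-withoutEdgeWeights G w P k = begin
  W ℚ.+ 0ℚ
    -- The single `0ℚ` is the trivial shift; a second one is inserted so that the two zeros match
    -- the two vanishing edge sums.
    ≡⟨ cong (ℚ._+ 0ℚ) (ℚ.+-identityʳ W) ⟨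
  W ℚ.+ 0ℚ ℚ.+ 0ℚ
    ≡⟨ cong₂ (λ x y → W ℚ.+ x ℚ.+ y) (sumOver-zero (E₁ G P)) (sumOver-zero (E₂ G P)) ⟨
  seq (pairCost G (withoutEdgeWeights G w) P) k ∎
  where
  open ≡-Reasoning
  W : ℚ
  W = seq (sumOver P w) k
  sumOver-zero : ∀ {n} (S : Subset n) → seq (sumOver S (λ _ → 0ℝ)) k ≡ 0ℚ
  sumOver-zero S = trans (seq-sumOver S (λ _ → 0ℝ) k) (∑-⊙-zero (lookup S))

≈-refl : ∀ x → x ≈ x
≈-refl x ε 0<ε = 0 , λ n _ → ℚ.≤-trans
  (ℚ.≤-reflexive (cong ℚ.∣_∣ (ℚ.+-inverseʳ (seq x n)))) (ℚ.<⇒≤ 0<ε)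

theorem7 : Equivalent VCPNEW MWVCP × Equivalent VCOP MWVCP × Equivalent VCUP MWVCP
theorem7 =
  ( shift⇒formulable VCPNEW MWVCP (λ G I → vertexWeights G I , offset G I , pairCost-shift G I)
  , shift⇒formulable MWVCP VCPNEW (λ G w →
      withoutEdgeWeights G w , (λ _ → 0ℚ) , λ P _ → pairCost-withoutEdgeWeights G w P))
  ,
  -- The special cases inherit the cost of `VCPNEW`, so its weights and offset serve again.
  -- Conversely, zero edge weights satisfy both restrictions.
  ( shift⇒formulable VCOP MWVCP (λ G (I , _) → vertexWeights G I , offset G I , pairCost-shift G I)
  , shift⇒formulable MWVCP VCOP (λ G w →
      (withoutEdgeWeights G w , λ _ → ≈-refl 0ℝ) ,
      (λ _ → 0ℚ) , λ P _ → pairCost-withoutEdgeWeights G w P))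
  ,
  ( shift⇒formulable VCUP MWVCP (λ G (I , _) → vertexWeights G I , offset G I , pairCost-shift G I)
  , shift⇒formulable MWVCP VCUP (λ G w →
      (withoutEdgeWeights G w , λ _ → ≈-refl 0ℝ) ,
      (λ _ → 0ℚ) , λ P _ → pairCost-withoutEdgeWeights G w P))
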